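{- Let $\exists X[F]$ be an $\exists$CNF formula (so $X\subseteq \mathrm{Vars}(F)$) and let $Z\subseteq X$. The variables of $Z$ are not redundant in $\exists X[F]$ if and only if there exist a set $W\subseteq Z$ and a $W$-boundary point of $F$ that is $X$-removable in $F$.
   Context: A clause is a disjunction of literals of Boolean variables; a CNF formula $F$ is a (finite) set of clauses, understood as their conjunction. $\mathrm{Vars}(\cdot)$ denotes the set of variables of a clause, formula or assignment. An $\exists$CNF formula is $\exists X[F]$ with $F$ a CNF formula and $X\subseteq \mathrm{Vars}(F)$; its free variables are $\mathrm{Vars}(F)\setminus X$, and $\equiv$ means equality of truth values under every complete assignment to the free variables. A clause $C$ is a $Z$-clause if $\mathrm{Vars}(C)\cap Z\neq\emptyset$; $F^Z$ is the set of all $Z$-clauses of $F$. The variables of $Z$ are redundant in $\exists X[F]$ if $\exists X[F]\equiv\exists X[F\setminus F^Z]$. A point of $F$ is an assignment $p$ with $\mathrm{Vars}(F)\subseteq\mathrm{Vars}(p)$. A point $p$ is a $Z$-boundary point of $F$ if (a) $Z\ne\emptyset$; (b) $p$ falsifies $F$; (c) every clause of $F$ falsified by $p$ is a $Z$-clause; (d) condition (c) fails for every proper subset of $Z$. A $Z$-boundary point $p$ of $F$ is $X$-removable in $F$ if $Z\subseteq X\subseteq\mathrm{Vars}(F)$ and there is a clause $C$ such that $F\Rightarrow C$, $p$ falsifies $C$, and $\mathrm{Vars}(C)\cap X=\emptyset$. -}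

module Defs where

open import Data.Bool using (Bool; not)
open import Data.List using (List; []; map; concatMap; filter)
open import Data.List.Membership.Propositional using (_∈_; _∉_)
import Data.List.Membership.DecPropositional as DecMembership
open import Data.List.Relation.Binary.Disjoint.Propositional using (Disjoint)
open import Data.List.Relation.Binary.Subset.Propositional using (_⊆_; _⊈_)
open import Data.List.Relation.Unary.All using (All)
open import Data.List.Relation.Unary.Any using (Any; any?)
open import Data.Maybe using (Maybe; just; Is-just)
open import Data.Product using (Σ-syntax; _×_)
open import Function.Bundles using (_⇔_)
open import Relation.Binary.Definitions using (DecidableEquality)
open import Relation.Binary.PropositionalEquality using (_≡_; _≢_)
open import Relation.Nullary using (¬_; ¬?)
open import Relation.Unary using (Decidable)

-- Finite sets (of variables, of literals, of clauses) are lists, considered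
-- only up to membership: order and repetitions never matter below.

module CNF {V : Set} (_≟_ : DecidableEquality V) where

  open DecMembership _≟_ using (_∈?_)

  -- polarity true is the literal v, polarity false is its negation.
  record Literal : Set where
    constructor lit
    field
      var      : V
      polarity : Bool
  open Literal public

  Clause : Set
  Clause = List Literal

  Formula : Set
  Formula = List Clause

  varsᶜ : Clause → List V
  varsᶜ = map var

  vars : Formula → List V
  vars = concatMap varsᶜ

  -- Assignments are partial: nothing means "not assigned".
  Assignment : Set
  Assignment = V → Maybe Bool

  _Assigns_ : Assignment → List V → Set
  p Assigns S = ∀ {v} → v ∈ S → Is-just (p v)

  SatisfiesClause : Assignment → Clause → Set
  SatisfiesClause p = Any λ l → p (var l) ≡ just (polarity l)

  FalsifiesClause : Assignment → Clause → Set
  FalsifiesClause p = All λ l → p (var l) ≡ just (not (polarity l))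

  Satisfies : Assignment → Formula → Set
  Satisfies p = All (SatisfiesClause p)

  Falsifies : Assignment → Formula → Set
  Falsifies p = Any (FalsifiesClause p)

  IsPoint : Formula → Assignment → Set
  IsPoint F p = p Assigns vars F

  Implies : Formula → Clause → Set
  Implies F C = ∀ p → p Assigns vars F → p Assigns varsᶜ C →
                Satisfies p F → SatisfiesClause p C

  -- The bound variables need not all occur in the matrix: this may fail for
  -- ∃X[F ∖ F^Z] even when X ⊆ Vars(F).
  record ∃CNF : Set where
    constructor ∃⟨_⟩_
    field
      bound  : List V
      matrix : Formula
  open ∃CNF public

  freeVars : ∃CNF → List V
  freeVars (∃⟨ X ⟩ F) = filter (λ v → ¬? (v ∈? X)) (vars F)

  -- Values that q may give to variables of X are ignored.
  TrueUnder : Assignment → ∃CNF → Set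
  TrueUnder q (∃⟨ X ⟩ F) =
    Σ[ p ∈ Assignment ]
      (∀ v → v ∉ X → p v ≡ q v) × p Assigns vars F × Satisfies p F

  infix 4 _≋_
  _≋_ : ∃CNF → ∃CNF → Set
  G ≋ H = ∀ q → q Assigns freeVars G → q Assigns freeVars H →
          TrueUnder q G ⇔ TrueUnder q H

  IsClauseOf : List V → Clause → Set
  IsClauseOf Z C = Any (_∈ Z) (varsᶜ C)

  isClauseOf? : ∀ Z → Decidable (IsClauseOf Z)
  isClauseOf? Z C = any? (_∈? Z) (varsᶜ C)

  -- F ∖ F^Z
  dropClausesOf : List V → Formula → Formula
  dropClausesOf Z = filter (λ C → ¬? (isClauseOf? Z C))

  Redundant : List V → ∃CNF → Set
  Redundant Z (∃⟨ X ⟩ F) = ∃⟨ X ⟩ F ≋ ∃⟨ X ⟩ dropClausesOf Z F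

  infix 4 _⊂_
  _⊂_ : List V → List V → Set
  S ⊂ T = S ⊆ T × T ⊈ S

  OnlyFalsifiesClausesOf : List V → Formula → Assignment → Set
  OnlyFalsifiesClausesOf Z F p =
    ∀ {C} → C ∈ F → FalsifiesClause p C → IsClauseOf Z C

  record IsBoundaryPoint (Z : List V) (F : Formula) (p : Assignment) : Set where
    field
      isPoint       : IsPoint F p
      nonempty      : Z ≢ []
      falsifies     : Falsifies p F
      onlyFalsifies : OnlyFalsifiesClausesOf Z F p
      minimal       : ∀ Z′ → Z′ ⊂ Z → ¬ OnlyFalsifiesClausesOf Z′ F p

  record Removable (X Z : List V) (F : Formula) (p : Assignment) : Set where
    field
      Z⊆X       : Z ⊆ X
      X⊆vars    : X ⊆ vars F
      clause    : Clause
      implied   : Implies F clause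
      falsified : FalsifiesClause p clause
      disjoint  : Disjoint (varsᶜ clause) X

{-# OPTIONS --safe #-}
module Submission where

open import Data.Bool using (Bool; true; false; not)
import Data.Bool.Properties as Boolₚ
open import Data.List using (List; []; _∷_; map; filter; length)
open import Data.List.Membership.Propositional using (_∈_; _∉_; find; lose)
open import Data.List.Membership.Propositional.Properties
  using (∈-filter⁺; ∈-filter⁻; ∈-map⁺; ∈-concatMap⁺; ∈-concatMap⁻)
import Data.List.Membership.DecPropositional as DecMembership
open import Data.List.Properties using (filter-notAll; map-∘; map-id)
open import Data.List.Relation.Binary.Subset.Propositional using (_⊆_)
open import Data.List.Relation.Unary.All as All using (All; []; _∷_)
import Data.List.Relation.Unary.All.Properties as All
open import Data.List.Relation.Unary.Any as Any using (here; there; any?)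
open import Data.Maybe using (just; nothing; fromMaybe)
open import Data.Maybe.Properties using (≡-dec; just-injective)
import Data.Maybe.Relation.Unary.Any as Maybe
open import Data.Nat using (_<_)
open import Data.Nat.Induction using (<-wellFounded)
open import Data.Product using (Σ-syntax; ∃-syntax; _×_; _,_; proj₁; proj₂)
open import Data.Sum using (_⊎_; inj₁; inj₂)
open import Data.Unit using (tt)
open import Function using (_∘_; id)
open import Function.Bundles using (_⇔_; mk⇔; Equivalence)
open import Induction.WellFounded using (Acc; acc)
open import Relation.Binary.Definitions using (DecidableEquality)
open import Relation.Binary.PropositionalEquality
open import Relation.Nullary using (¬_; ¬?; Dec; yes; no; _×-dec_; _→-dec_; contradiction)
open import Relation.Nullary.Decidable using (map′; decidable-stable)
open import Relation.Unary using (Decidable)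
open import Defs

-- The variables of Z fail to be redundant exactly when some point p satisfies
-- F ∖ F^Z while no point agreeing with p outside X satisfies F.  Such a p
-- falsifies only Z-clauses, hence is a W-boundary point for any W ⊆ Z minimal
-- with that property, and it is removed by the longest clause over the free
-- variables that p falsifies: a point satisfying F but not this clause would
-- agree with p outside X.  Conversely, the clause removing a W-boundary point
-- p prevents every point that agrees with p outside X from satisfying F.
-- Finiteness of the search for p makes the argument constructive.

module _ {V : Set} (_≟_ : DecidableEquality V) where

  open CNF _≟_
  open DecMembership _≟_ using (_∈?_)

  -- Minimal subsets with a decidable monotone property

  remove : V → List V → List V
  remove v = filter (λ w → ¬? (w ≟ v))

  length-remove : ∀ {v S} → v ∈ S → length (remove v S) < length S
  length-remove v∈S = filter-notAll _ _ (Any.map (λ v≡w w≢v → w≢v (sym v≡w)) v∈S)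

  -- Monotonicity reduces minimality to deleting single elements: a proper subset `T` misses some
  -- `v` of `S`, hence lies inside `remove v S`. Since `remove` drops every repetition of `v`, lists
  -- behave as sets here and the length strictly decreases.
  minimalSubset : {P : List V → Set} → Decidable P → (∀ {S T} → S ⊆ T → P S → P T) →
                  ∀ S → P S → Σ[ W ∈ List V ] (W ⊆ S × P W × (∀ T → T ⊂ W → ¬ P T))
  minimalSubset {P} P? P-mono S = go S (<-wellFounded (length S))
    where
    go : ∀ S → Acc _<_ (length S) → P S →
         Σ[ W ∈ List V ] (W ⊆ S × P W × (∀ T → T ⊂ W → ¬ P T))
    go S (acc rec) PS with any? (λ v → P? (remove v S)) S
    ... | yes removable =
      let v , v∈S , PS-v = find removable
          W , W⊆S-v , rest = go (remove v S) (rec (length-remove v∈S)) PS-v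
      in W , proj₁ ∘ ∈-filter⁻ _ ∘ W⊆S-v , rest
    ... | no ¬removable = S , id , PS , minimal
      where
      minimal : ∀ T → T ⊂ S → ¬ P T
      minimal T (T⊆S , S⊈T) PT = S⊈T λ {v} v∈S → decidable-stable (v ∈? T) λ v∉T →
        ¬removable (lose v∈S (P-mono
          (λ w∈T → ∈-filter⁺ _ (T⊆S w∈T) λ { refl → v∉T w∈T }) PT))

  -- Evaluation under partial assignments

  var∈vars : ∀ {F C l} → C ∈ F → l ∈ C → var l ∈ vars F
  var∈vars C∈F l∈C = ∈-concatMap⁺ varsᶜ (lose C∈F (∈-map⁺ var l∈C))

  vars-mono : ∀ {F G} → G ⊆ F → vars G ⊆ vars F
  vars-mono {F} {G} G⊆F v∈G =
    let C , C∈G , v∈C = find (∈-concatMap⁻ varsᶜ {xs = G} v∈G)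
    in ∈-concatMap⁺ varsᶜ (lose (G⊆F C∈G) v∈C)

  -- The default `true` is never reached at an assigned variable, so `fromMaybe true (p v)` can
  -- stand for its Boolean value.
  value : ∀ {p : Assignment} {S v} → p Assigns S → v ∈ S → p v ≡ just (fromMaybe true (p v))
  value {p} {v = v} pS v∈S with p v | pS v∈S
  ... | just _ | _ = refl

  satisfiesClause? : ∀ p → Decidable (SatisfiesClause p)
  satisfiesClause? p = any? λ l → ≡-dec Boolₚ._≟_ (p (var l)) (just (polarity l))

  falsifiesClause? : ∀ p → Decidable (FalsifiesClause p)
  falsifiesClause? p = All.all? λ l → ≡-dec Boolₚ._≟_ (p (var l)) (just (not (polarity l)))

  satisfies? : ∀ p → Decidable (Satisfies p)
  satisfies? p = All.all? (satisfiesClause? p)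

  -- One true literal per clause witnesses satisfaction, so it survives assigning further variables.
  satisfies-mono : ∀ {p r F} → (∀ {v b} → v ∈ vars F → p v ≡ just b → r v ≡ just b) →
                   Satisfies p F → Satisfies r F
  satisfies-mono p⊑r pF = All.tabulate λ C∈F →
    let l , l∈C , pl = find (All.lookup pF C∈F)
    in lose l∈C (p⊑r (var∈vars C∈F l∈C) pl)

  satisfies-cong : ∀ {p r F} → (∀ {v} → v ∈ vars F → p v ≡ r v) →
                   Satisfies p F → Satisfies r F
  satisfies-cong p≡r = satisfies-mono λ v∈F pv → trans (sym (p≡r v∈F)) pv

  ¬satisfies∧falsifies : ∀ {p C} → SatisfiesClause p C → ¬ FalsifiesClause p C
  ¬satisfies∧falsifies pC ¬pC =
    let l , l∈C , pl = find pC
    in Boolₚ.not-¬ refl (just-injective (trans (sym pl) (All.lookup ¬pC l∈C)))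

  satisfies⊎falsifies : ∀ {p} C → p Assigns varsᶜ C → SatisfiesClause p C ⊎ FalsifiesClause p C
  satisfies⊎falsifies [] _ = inj₂ []
  satisfies⊎falsifies {p} (lit v b ∷ C) pC
    with Boolₚ._≟_ (fromMaybe true (p v)) b | satisfies⊎falsifies C (pC ∘ there)
  ... | yes pv≡b | _        = inj₁ (here (trans (value pC (here refl)) (cong just pv≡b)))
  ... | no _     | inj₁ pC′ = inj₁ (there pC′)
  ... | no pv≢b  | inj₂ pC′ =
    inj₂ (trans (value pC (here refl)) (cong just (Boolₚ.¬-not pv≢b)) ∷ pC′)

  clause-assigned : ∀ {F p C} → IsPoint F p → C ∈ F → p Assigns varsᶜ C
  clause-assigned pF C∈F v∈C = pF (∈-concatMap⁺ varsᶜ (lose C∈F v∈C))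

  ¬satisfies⇒falsifies : ∀ {F p} → IsPoint F p → ¬ Satisfies p F → Falsifies p F
  ¬satisfies⇒falsifies {F} {p} point ¬pF =
    let C , C∈F , ¬pC = find (All.¬All⇒Any¬ (satisfiesClause? p) F ¬pF)
    in lose C∈F (falsified ¬pC (satisfies⊎falsifies C (clause-assigned point C∈F)))
    where
    falsified : ∀ {C} → ¬ SatisfiesClause p C →
                SatisfiesClause p C ⊎ FalsifiesClause p C → FalsifiesClause p C
    falsified ¬pC (inj₁ pC)  = contradiction pC ¬pC
    falsified _   (inj₂ ¬pC) = ¬pC

  -- Deletion of the clauses that meet `Z`

  dropClausesOf-⊆ : ∀ Z F → dropClausesOf Z F ⊆ F
  dropClausesOf-⊆ Z F = proj₁ ∘ ∈-filter⁻ (λ C → ¬? (isClauseOf? Z C))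

  satisfies-drop⇒onlyFalsifies : ∀ {Z F p} → Satisfies p (dropClausesOf Z F) →
                                 OnlyFalsifiesClausesOf Z F p
  satisfies-drop⇒onlyFalsifies {Z} {F} pD {C} C∈F ¬pC =
    decidable-stable (isClauseOf? Z C) λ ¬ZC →
      ¬satisfies∧falsifies (All.lookup pD (∈-filter⁺ (λ C → ¬? (isClauseOf? Z C)) C∈F ¬ZC)) ¬pC

  -- Being a point excludes clauses that are neither satisfied nor falsified; a clause outside `F^Z`
  -- is not falsified, so it is satisfied.
  onlyFalsifies⇒satisfies-drop : ∀ {Z F p} → IsPoint F p → OnlyFalsifiesClausesOf Z F p →
                                 Satisfies p (dropClausesOf Z F)
  onlyFalsifies⇒satisfies-drop {Z} {F} {p} point only = All.tabulate λ {C} C∈D →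
    let C∈F , ¬ZC = ∈-filter⁻ (λ C → ¬? (isClauseOf? Z C)) {xs = F} C∈D
    in satisfied C∈F ¬ZC (satisfies⊎falsifies C (clause-assigned point C∈F))
    where
    satisfied : ∀ {C} → C ∈ F → ¬ IsClauseOf Z C →
                SatisfiesClause p C ⊎ FalsifiesClause p C → SatisfiesClause p C
    satisfied _   _   (inj₁ pC)  = pC
    satisfied C∈F ¬ZC (inj₂ ¬pC) = contradiction (only C∈F ¬pC) ¬ZC

  onlyFalsifies-mono : ∀ {F p S T} → S ⊆ T →
                       OnlyFalsifiesClausesOf S F p → OnlyFalsifiesClausesOf T F p
  onlyFalsifies-mono S⊆T only C∈F ¬pC = Any.map S⊆T (only C∈F ¬pC)

  onlyFalsifies? : ∀ F p → Decidable (λ Z → OnlyFalsifiesClausesOf Z F p)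
  onlyFalsifies? F p Z = map′ (λ a C∈F → All.lookup a C∈F) (λ only → All.tabulate only)
    (All.all? (λ C → falsifiesClause? p C →-dec isClauseOf? Z C) F)

  -- Finite search through the variants of an assignment

  Variant : List V → Assignment → Assignment → Set
  Variant S p r = (∀ v → v ∉ S → r v ≡ p v) × r Assigns S

  _[_≔_] : Assignment → V → Bool → Assignment
  (p [ v ≔ b ]) w with w ≟ v
  ... | yes _ = just b
  ... | no _  = p w

  ≔-same : ∀ p v b → (p [ v ≔ b ]) v ≡ just b
  ≔-same p v b with v ≟ v
  ... | yes _  = refl
  ... | no v≢v = contradiction refl v≢v

  ≔-other : ∀ p {v w} b → w ≢ v → (p [ v ≔ b ]) w ≡ p w
  ≔-other p {v} {w} b w≢v with w ≟ v
  ... | yes w≡v = contradiction w≡v w≢v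
  ... | no _    = refl

  variant-cons⁺ : ∀ {v S p r} b → Variant S (p [ v ≔ b ]) r → Variant (v ∷ S) p r
  variant-cons⁺ {v} {S} {p} {r} b (r≡p , rS) =
    (λ w w∉ → trans (r≡p w (w∉ ∘ there)) (≔-other p b (w∉ ∘ here))) , assigned
    where
    assigned : r Assigns (v ∷ S)
    assigned (there w∈S) = rS w∈S
    -- The list may repeat `v`. If so, the tail already assigns it; otherwise `r` keeps the value
    -- `b` set at `v`.
    assigned (here refl) with v ∈? S
    ... | yes v∈S = rS v∈S
    ... | no v∉S rewrite r≡p v v∉S | ≔-same p v b = Maybe.just tt

  -- The Boolean is the value of `r` at `v`; a search over `v ∷ S` thus splits into two searches
  -- over `S`.
  variant-cons⁻ : ∀ {v S p r} → Variant (v ∷ S) p r → ∃[ b ] Variant S (p [ v ≔ b ]) r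
  variant-cons⁻ {v} {S} {p} {r} (r≡p , rS) = b , agree , rS ∘ there
    where
    b = fromMaybe true (r v)
    agree : ∀ w → w ∉ S → r w ≡ (p [ v ≔ b ]) w
    agree w w∉S with w ≟ v
    ... | yes refl = value {r} rS (here refl)
    ... | no w≢v   = r≡p w λ { (here w≡v) → w≢v w≡v ; (there w∈S) → w∉S w∈S }

  -- Without function extensionality, P has to respect pointwise equality.
  variant? : {P : Assignment → Set} → Decidable P → (∀ {p r} → p ≗ r → P p → P r) →
             ∀ S p → Dec (Σ[ r ∈ Assignment ] (Variant S p r × P r))
  variant? P? P-resp [] p =
    map′ (λ Pp → p , ((λ _ _ → refl) , λ ()) , Pp)
         (λ (r , (r≡p , _) , Pr) → P-resp (λ v → r≡p v λ ()) Pr)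
         (P? p)
  variant? P? P-resp (v ∷ S) p
    with variant? P? P-resp S (p [ v ≔ true ]) | variant? P? P-resp S (p [ v ≔ false ])
  ... | yes (r , var , Pr) | _                  = yes (r , variant-cons⁺ true var , Pr)
  ... | no _               | yes (r , var , Pr) = yes (r , variant-cons⁺ false var , Pr)
  ... | no ¬t              | no ¬f              = no λ (r , var , Pr) →
    case (variant-cons⁻ var) Pr
    where
    case : ∀ {r} → ∃[ b ] Variant S (p [ v ≔ b ]) r → ¬ _
    case (true  , var) Pr = ¬t (_ , var , Pr)
    case (false , var) Pr = ¬f (_ , var , Pr)

  -- Overlays and blocking clauses

  overlay : List V → Assignment → Assignment → Assignment
  overlay S r p v with v ∈? S
  ... | yes _ = r v
  ... | no _  = p v

  overlay-∈ : ∀ {S v} r p → v ∈ S → overlay S r p v ≡ r v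
  overlay-∈ {S} {v} r p v∈S with v ∈? S
  ... | yes _  = refl
  ... | no v∉S = contradiction v∈S v∉S

  overlay-∉ : ∀ {S v} r p → v ∉ S → overlay S r p v ≡ p v
  overlay-∉ {S} {v} r p v∉S with v ∈? S
  ... | yes v∈S = contradiction v∈S v∉S
  ... | no _    = refl

  -- Carries satisfaction of a formula from `r` to the overlay when `r` and `p` agree on its
  -- variables outside `S`.
  overlay-agree : ∀ {S r p} {v} → (v ∉ S → r v ≡ p v) → overlay S r p v ≡ r v
  overlay-agree {S} {v = v} r≡p with v ∈? S
  ... | yes _  = refl
  ... | no v∉S = sym (r≡p v∉S)

  overlay-variant : ∀ {S r} p → r Assigns S → Variant S p (overlay S r p)
  overlay-variant {S} {r} p rS =
    (λ _ → overlay-∉ r p) , λ v∈S → subst (Maybe.Any _) (sym (overlay-∈ r p v∈S)) (rS v∈S)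

  -- The blocking clause of `p` on `S`: if `p` assigns `S`, exactly the assignments agreeing with
  -- `p` on `S` falsify it.
  falsifiedClause : Assignment → List V → Clause
  falsifiedClause p = map λ v → lit v (not (fromMaybe true (p v)))

  varsᶜ-falsifiedClause : ∀ p S → varsᶜ (falsifiedClause p S) ≡ S
  varsᶜ-falsifiedClause p S = trans (sym (map-∘ S)) (map-id S)

  falsifies-falsifiedClause : ∀ {p S} → p Assigns S → FalsifiesClause p (falsifiedClause p S)
  falsifies-falsifiedClause pS = All.map⁺ (All.tabulate λ v∈S →
    trans (value pS v∈S) (cong just (sym (Boolₚ.not-involutive _))))

  falsifiedClause-agree : ∀ {p r S v} → p Assigns S → FalsifiesClause r (falsifiedClause p S) →
                          v ∈ S → r v ≡ p v
  falsifiedClause-agree pS ¬rC v∈S = trans (All.lookup (All.map⁻ ¬rC) v∈S)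
    (trans (cong just (Boolₚ.not-involutive _)) (sym (value pS v∈S)))

  -- Obstructions to redundancy

  module _ (X : List V) (F : Formula) where

    -- A decidable substitute for `TrueUnder p (∃⟨ X ⟩ F)`: the witness has to assign `X` rather
    -- than `vars F`, which leaves two choices per variable of `X`.
    SatisfiableOver : Assignment → Set
    SatisfiableOver p = Σ[ r ∈ Assignment ] (Variant X p r × Satisfies r F)

    satisfiableOver? : Decidable SatisfiableOver
    satisfiableOver? = variant? (λ r → satisfies? r F) (λ p≗r → satisfies-cong λ _ → p≗r _) X

    satisfiableOver-resp : ∀ {p r} → p ≗ r → SatisfiableOver p → SatisfiableOver r
    satisfiableOver-resp p≗r (s , (s≡p , sX) , sF) =
      s , ((λ v v∉X → trans (s≡p v v∉X) (p≗r v)) , sX) , sF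

    Obstruction : List V → Assignment → Set
    Obstruction Z p = Satisfies p (dropClausesOf Z F) × ¬ SatisfiableOver p

    -- Starting from the nowhere defined assignment, the outer search meets every point defined
    -- exactly on `vars F`; each one is tested by an inner search over `X`.
    obstruction? : ∀ Z →
                   Dec (Σ[ p ∈ Assignment ] (Variant (vars F) (λ _ → nothing) p × Obstruction Z p))
    obstruction? Z = variant?
      (λ p → satisfies? p (dropClausesOf Z F) ×-dec ¬? (satisfiableOver? p))
      (λ p≗r (pD , ¬p) → satisfies-cong (λ _ → p≗r _) pD ,
                         ¬p ∘ satisfiableOver-resp (sym ∘ p≗r))
      (vars F) _

    ∈-freeVars : ∀ {v} → v ∈ vars F → v ∉ X → v ∈ freeVars (∃⟨ X ⟩ F)
    ∈-freeVars = ∈-filter⁺ (λ v → ¬? (v ∈? X))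

    noObstruction⇒redundant :
      ∀ Z → (∀ {p} → Variant (vars F) (λ _ → nothing) p → ¬ Obstruction Z p) →
      Redundant Z (∃⟨ X ⟩ F)
    noObstruction⇒redundant Z noObstruction q qF _ = mk⇔ weaken strengthen
      where
      weaken : TrueUnder q (∃⟨ X ⟩ F) → TrueUnder q (∃⟨ X ⟩ dropClausesOf Z F)
      weaken (p , p≡q , point , pF) =
        p , p≡q , point ∘ vars-mono (dropClausesOf-⊆ Z F) ,
        All.anti-mono (dropClausesOf-⊆ Z F) pF

      strengthen : TrueUnder q (∃⟨ X ⟩ dropClausesOf Z F) → TrueUnder q (∃⟨ X ⟩ F)
      strengthen (p , p≡q , _ , pD) =
        -- Outside `vars F` and `X` the solution `r` is undefined, whereas `TrueUnder` demands
        -- agreement with `q` there; so `r` is used on `X` only.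
        overlay X r q , (λ _ → overlay-∉ r q) , assigned ,
        satisfies-cong (λ v∈F → sym (overlay-agree (r≡q v∈F))) rF
        where
        -- Variables of `X` occurring only in deleted clauses may be unassigned by `p`; the default
        -- `true` fills them in.
        completed : Assignment
        completed v = just (fromMaybe true (p v))

        -- Erasing the values outside `vars F` places `p̂` among the assignments covered by
        -- `noObstruction`.
        p̂ : Assignment
        p̂ = overlay (vars F) completed (λ _ → nothing)

        p̂-variant : Variant (vars F) (λ _ → nothing) p̂
        p̂-variant = overlay-variant _ λ _ → Maybe.just tt

        p̂D : Satisfies p̂ (dropClausesOf Z F)
        p̂D = satisfies-mono
          (λ v∈D pv → trans (overlay-∈ completed _ (vars-mono (dropClausesOf-⊆ Z F) v∈D))
                            (cong (just ∘ fromMaybe true) pv))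
          pD

        solution : SatisfiableOver p̂
        solution = decidable-stable (satisfiableOver? p̂) λ ¬p̂ → noObstruction p̂-variant (p̂D , ¬p̂)

        r    = proj₁ solution
        r≡p̂ = proj₁ (proj₁ (proj₂ solution))
        rX   = proj₂ (proj₁ (proj₂ solution))
        rF   = proj₂ (proj₂ solution)

        r≡q : ∀ {v} → v ∈ vars F → v ∉ X → r v ≡ q v
        r≡q {v} v∈F v∉X = begin
          r v                         ≡⟨ r≡p̂ v v∉X ⟩
          p̂ v                        ≡⟨ overlay-∈ completed _ v∈F ⟩
          just (fromMaybe true (p v)) ≡⟨ cong (just ∘ fromMaybe true) (p≡q v v∉X) ⟩
          just (fromMaybe true (q v)) ≡⟨ value qF (∈-freeVars v∈F v∉X) ⟨
          q v                         ∎
          where open ≡-Reasoning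

        assigned : overlay X r q Assigns vars F
        assigned {v} v∈F with v ∈? X
        ... | yes v∈X = rX v∈X
        ... | no v∉X  = qF (∈-freeVars v∈F v∉X)

    obstruction⇒removable : ∀ {Z W p} → X ⊆ vars F → W ⊆ X → IsPoint F p → Obstruction Z p →
                            Removable X W F p
    obstruction⇒removable {p = p} X⊆F W⊆X point (_ , ¬p) = record
      { Z⊆X       = W⊆X
      ; X⊆vars    = X⊆F
      ; clause    = C
      ; implied   = implied
      ; falsified = falsifies-falsifiedClause pFree
      ; disjoint  = λ {v} (v∈C , v∈X) →
          proj₂ (∈-filter⁻ (λ v → ¬? (v ∈? X)) {xs = vars F}
                   (subst (v ∈_) (varsᶜ-falsifiedClause p free) v∈C)) v∈X
      }
      where
      free = freeVars (∃⟨ X ⟩ F)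
      C = falsifiedClause p free

      pFree : p Assigns free
      pFree v∈free = point (proj₁ (∈-filter⁻ (λ v → ¬? (v ∈? X)) v∈free))

      implied : Implies F C
      implied s sF sC sat with satisfies⊎falsifies C sC
      ... | inj₁ sC = sC
      -- Falsifying `C` makes `s` agree with `p` on the free variables, so the values of `s` on `X`
      -- turn `p` into a variant satisfying `F`.
      ... | inj₂ ¬sC = contradiction
        ( overlay X s p
        , overlay-variant p (sF ∘ X⊆F)
        , satisfies-cong (λ v∈F → sym (overlay-agree λ v∉X →
            falsifiedClause-agree pFree ¬sC (∈-freeVars v∈F v∉X))) sat )
        ¬p

    obstruction⇒boundary : ∀ {Z p} → X ⊆ vars F → IsPoint F p → Obstruction Z p →
                           Σ[ W ∈ List V ] (W ⊆ Z × IsBoundaryPoint W F p)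
    obstruction⇒boundary {Z} {p} X⊆F point (pD , ¬p) =
      let W , W⊆Z , only , minimal = minimalSubset (onlyFalsifies? F p)
            (λ S⊆T → onlyFalsifies-mono {F} {p} S⊆T)
            Z (satisfies-drop⇒onlyFalsifies {Z} {F} pD)
      in W , W⊆Z , record
        { isPoint       = point
        ; nonempty      = nonempty only
        ; falsifies     = ¬pF
        ; onlyFalsifies = only
        ; minimal       = minimal
        }
      where
      ¬pF : Falsifies p F
      -- If `p` satisfied `F`, it would be a satisfying variant of itself.
      ¬pF = ¬satisfies⇒falsifies point λ pF → ¬p (p , ((λ _ _ → refl) , point ∘ X⊆F) , pF)

      nonempty : ∀ {W} → OnlyFalsifiesClausesOf W F p → W ≢ []
      nonempty only refl with find ¬pF
      ... | C , C∈F , ¬pC with find (only C∈F ¬pC)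
      ...   | _ , _ , ()

    -- Redundancy is applied at `p` itself, which satisfies all clauses outside `F^Z`. It would
    -- yield an `s` satisfying `F` and equal to `p` outside `X`; being disjoint from `X`, the
    -- removing clause stays falsified by `s`, although `F` implies it.
    removable⇒¬redundant : ∀ {Z W p} → W ⊆ Z → IsBoundaryPoint W F p → Removable X W F p →
                           ¬ Redundant Z (∃⟨ X ⟩ F)
    removable⇒¬redundant {Z} {W} {p} W⊆Z boundary removable redundant =
      let s , s≡p , sF , sat = Equivalence.from
            (redundant p (point ∘ proj₁ ∘ ∈-filter⁻ _)
                         (point ∘ vars-mono (dropClausesOf-⊆ Z F) ∘ proj₁ ∘ ∈-filter⁻ _))
            (p , (λ _ _ → refl) , point ∘ vars-mono (dropClausesOf-⊆ Z F) , pD)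
          ¬sC : FalsifiesClause s clause
          ¬sC = All.tabulate λ l∈C →
            trans (s≡p _ λ v∈X → disjoint (∈-map⁺ var l∈C , v∈X)) (All.lookup falsified l∈C)
      in ¬satisfies∧falsifies (implied s sF (falsifies⇒assigns ¬sC) sat) ¬sC
      where
      open IsBoundaryPoint boundary renaming (isPoint to point)
      open Removable removable

      pD : Satisfies p (dropClausesOf Z F)
      pD = onlyFalsifies⇒satisfies-drop point
             (onlyFalsifies-mono {F} {p} W⊆Z onlyFalsifies)

      falsifies⇒assigns : ∀ {s C} → FalsifiesClause s C → s Assigns varsᶜ C
      falsifies⇒assigns (sl ∷ _)  (here refl) rewrite sl = Maybe.just tt
      falsifies⇒assigns (_ ∷ ¬sC) (there v∈C) = falsifies⇒assigns ¬sC v∈C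

proposition2 : {V : Set} (_≟_ : DecidableEquality V) → let open CNF _≟_ in
    (X : List V) (F : Formula) → X ⊆ vars F →
    (Z : List V) → Z ⊆ X →
    (¬ Redundant Z (∃⟨ X ⟩ F)) ⇔
    (Σ[ W ∈ List V ] (W ⊆ Z × (Σ[ p ∈ Assignment ] (IsBoundaryPoint W F p × Removable X W F p))))
proposition2 {V} _≟_ X F X⊆F Z Z⊆X = mk⇔ to from
  where
  open CNF _≟_

  to : ¬ Redundant Z (∃⟨ X ⟩ F) →
       Σ[ W ∈ List V ] (W ⊆ Z × (Σ[ p ∈ Assignment ] (IsBoundaryPoint W F p × Removable X W F p)))
  -- The hypothesis is a mere negation; the exhaustive search supplies the actual point.
  to ¬redundant with obstruction? _≟_ X F Z
  ... | no ¬obstruction = contradiction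
    (noObstruction⇒redundant _≟_ X F Z λ var obstruction → ¬obstruction (_ , var , obstruction))
    ¬redundant
  ... | yes (p , (_ , point) , obstruction) =
    let W , W⊆Z , boundary = obstruction⇒boundary _≟_ X F X⊆F point obstruction
    in W , W⊆Z , p , boundary , obstruction⇒removable _≟_ X F X⊆F (Z⊆X ∘ W⊆Z) point obstruction

  from : Σ[ W ∈ List V ] (W ⊆ Z × (Σ[ p ∈ Assignment ] (IsBoundaryPoint W F p × Removable X W F p))) →
         ¬ Redundant Z (∃⟨ X ⟩ F)
  from (_ , W⊆Z , _ , boundary , removable) =
    removable⇒¬redundant _≟_ X F W⊆Z boundary removable
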